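{- Any $l$-regular exactly $\lambda$-connected CNF formula is uniform, i.e. each clause has the same number $k$ of variables, given by $$\lambda(m-1)=k(l-1),$$ where $m$ is the number of clauses of the formula.
   Context: All CNF formulas are assumed monotone (all literals are of one kind), so a clause $C$ is identified with its set of variables $Var(C)$. An exactly $\lambda$-connected CNF formula is a set $F$ of clauses $C_i$ over a variable set $Var(F)$ with $C_i\in 2^{Var(F)}$ such that any two clauses have exactly $\lambda$ variables in common. It is $l$-regular if each variable occurs exactly $l$ times, i.e. in exactly $l$ clauses.
   Formalization: The formula is assumed to have at least one clause, and the case λ = 0 with l = 1 is excluded: there the claim fails, e.g. {{x},{y,z}} is 1-regular and exactly 0-connected but not uniform. -}

module Defs where

open import Data.Nat.Base using (ℕ)
open import Data.Fin.Base using (Fin)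
open import Data.Fin.Subset using (Subset; _∈_; _∩_; ⋃; ∣_∣)
open import Data.Fin.Subset.Properties using (_∈?_)
open import Data.List.Base using (List; length; filter)
import Data.List.Membership.Propositional as List
open import Data.List.Relation.Unary.Unique.Propositional using (Unique)
open import Relation.Binary.PropositionalEquality using (_≡_; _≢_)

-- Monotone: all literals have the same polarity, so a clause is its set of
-- variables.
Clause : ℕ → Set
Clause = Subset

-- A set of clauses, listed without repetition, with variables drawn from Fin n.
-- Elements of Fin n need not occur in the formula.
record Formula (n : ℕ) : Set where
  constructor formula
  field
    clauses  : List (Clause n)
    distinct : Unique clauses

open Formula public

module _ {n : ℕ} where

  infix 4 _∈ᶠ_

  _∈ᶠ_ : Clause n → Formula n → Set
  C ∈ᶠ F = C List.∈ clauses F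

  size : Formula n → ℕ
  size F = length (clauses F)

  Var : Formula n → Subset n
  Var F = ⋃ (clauses F)

  occurrences : Formula n → Fin n → ℕ
  occurrences F x = length (filter (x ∈?_) (clauses F))

  Regular : ℕ → Formula n → Set
  Regular l F = ∀ x → x ∈ Var F → occurrences F x ≡ l

  ExactlyConnected : ℕ → Formula n → Set
  ExactlyConnected lam F =
    ∀ C D → C ∈ᶠ F → D ∈ᶠ F → C ≢ D → ∣ C ∩ D ∣ ≡ lam

  Uniform : ℕ → Formula n → Set
  Uniform k F = ∀ C → C ∈ᶠ F → ∣ C ∣ ≡ k

{-# OPTIONS --safe #-}

-- Fix a clause C and count the pairs (x, D) with x ∈ C ∩ D.  Summing over
-- x ∈ C gives ∣ C ∣ l by regularity; summing over D gives ∣ C ∣ from D = C and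
-- λ from each of the other m − 1 clauses.  Hence ∣ C ∣ l = ∣ C ∣ + (m − 1) λ,
-- which determines ∣ C ∣ unless l = 1; in that case (m − 1) λ = 0, so λ ≠ 0
-- leaves only a single clause.
module Submission where

open import Defs
open import Algebra.Properties.CommutativeSemigroup using (x∙yz≈y∙xz)
open import Data.Bool.Base using (true; false)
open import Data.Fin.Base using (Fin; zero; suc)
open import Data.Fin.Subset using (Subset; inside; outside; _∈_; _∩_; ⋃; ∣_∣)
open import Data.Fin.Subset.Properties using (_∈?_; p⊆p∪q; q⊆p∪q; ∩-idem)
open import Data.List.Base using (List; []; _∷_; length; filter; map)
open import Data.List.Membership.Propositional using () renaming (_∈_ to _∈ˡ_)
open import Data.List.Relation.Unary.All using (lookup)
open import Data.List.Relation.Unary.AllPairs using (_∷_)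
open import Data.List.Relation.Unary.Any using (here; there)
open import Data.List.Relation.Unary.Unique.Propositional using (Unique)
open import Data.Nat.Base using (ℕ; zero; suc; _<_)
import Data.Nat.Base as ℕ
open import Data.Nat.ListAction using (sum)
import Data.Nat.Properties as ℕ
open import Data.Product.Base using (_×_; _,_; ∃-syntax)
open import Data.Sum.Base using (inj₁; inj₂)
open import Data.Vec.Base using ([]; _∷_; here; there; tail)
open import Function.Base using (_∘_)
open import Relation.Binary.PropositionalEquality
open import Relation.Nullary.Decidable.Core using (yes; no; does)
open import Relation.Nullary.Negation using (¬_; contradiction)
open import Data.Integer.Base using (+_; _*_; _-_)
import Data.Integer.Base as ℤ
import Data.Integer.Properties as ℤ
open import Data.Integer.Tactic.RingSolver using (solve-∀)
open ≡-Reasoning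

private variable
  n : ℕ

+-exchange : ∀ x y z → x ℕ.+ (y ℕ.+ z) ≡ y ℕ.+ (x ℕ.+ z)
+-exchange = x∙yz≈y∙xz ℕ.+-commutativeSemigroup

∈-⋃ : ∀ {x} {C : Subset n} {Cs} → C ∈ˡ Cs → x ∈ C → x ∈ ⋃ Cs
∈-⋃ {Cs = _ ∷ Cs} (here refl) x∈C = p⊆p∪q (⋃ Cs) x∈C
∈-⋃ {Cs = D ∷ Cs} (there C∈) x∈C = q⊆p∪q D (⋃ Cs) (∈-⋃ C∈ x∈C)

-- Taken over a bare list rather than a `Formula`: the induction on the number of variables passes
-- to `map tail Ds`, whose entries may coincide.
degree : List (Subset n) → Fin n → ℕ
degree Ds x = length (filter (x ∈?_) Ds)

intersections : Subset n → List (Subset n) → ℕ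
intersections C Ds = sum (map (λ D → ∣ C ∩ D ∣) Ds)

degree-suc : ∀ (Ds : List (Subset (suc n))) x → degree Ds (suc x) ≡ degree (map tail Ds) x
degree-suc [] x = refl
degree-suc ((_ ∷ D) ∷ Ds) x with does (x ∈? D)
... | true  = cong suc (degree-suc Ds x)
... | false = degree-suc Ds x

intersections-outside : ∀ (C : Subset n) Ds →
  intersections (outside ∷ C) Ds ≡ intersections C (map tail Ds)
intersections-outside C [] = refl
intersections-outside C ((_ ∷ D) ∷ Ds) = cong (∣ C ∩ D ∣ ℕ.+_) (intersections-outside C Ds)

-- Variable `zero` lies in `C`, so it adds one to `∣ C ∩ D ∣` for each `D` containing it, hence its
-- degree in total.
intersections-inside : ∀ (C : Subset n) Ds →
  intersections (inside ∷ C) Ds ≡ degree Ds zero ℕ.+ intersections C (map tail Ds)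
intersections-inside C [] = refl
intersections-inside C ((s ∷ D) ∷ Ds) = by-head s
  where
  step : ∣ C ∩ D ∣ ℕ.+ intersections (inside ∷ C) Ds ≡
         degree Ds zero ℕ.+ (∣ C ∩ D ∣ ℕ.+ intersections C (map tail Ds))
  step = trans (cong (∣ C ∩ D ∣ ℕ.+_) (intersections-inside C Ds))
               (+-exchange ∣ C ∩ D ∣ (degree Ds zero) _)

  by-head : ∀ s → intersections (inside ∷ C) ((s ∷ D) ∷ Ds) ≡
    degree ((s ∷ D) ∷ Ds) zero ℕ.+ intersections C (D ∷ map tail Ds)
  by-head inside  = cong suc step
  by-head outside = step

-- Double counting, by peeling off one variable at a time: it contributes its degree `l` when it
-- lies in `C` and nothing otherwise.
intersections-regular : ∀ {l} (C : Subset n) Ds → (∀ x → x ∈ C → degree Ds x ≡ l) →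
  intersections C Ds ≡ ∣ C ∣ ℕ.* l
intersections-regular [] [] _ = refl
intersections-regular {l = l} [] ([] ∷ Ds) _ = intersections-regular {l = l} [] Ds λ _ ()
intersections-regular {l = l} (s ∷ C) Ds = by-head s
  where
  tails : (∀ x → x ∈ C → degree Ds (suc x) ≡ l) → intersections C (map tail Ds) ≡ ∣ C ∣ ℕ.* l
  tails reg = intersections-regular C (map tail Ds) λ x x∈C →
    trans (sym (degree-suc Ds x)) (reg x x∈C)

  by-head : ∀ s → (∀ x → x ∈ s ∷ C → degree Ds x ≡ l) →
    intersections (s ∷ C) Ds ≡ ∣ s ∷ C ∣ ℕ.* l
  by-head outside reg = trans (intersections-outside C Ds) (tails λ x → reg (suc x) ∘ there)
  by-head inside  reg = trans (intersections-inside C Ds)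
    (cong₂ ℕ._+_ (reg zero here) (tails λ x → reg (suc x) ∘ there))

intersections-constant : ∀ {lam} (C : Subset n) Ds → (∀ D → D ∈ˡ Ds → ∣ C ∩ D ∣ ≡ lam) →
  intersections C Ds ≡ length Ds ℕ.* lam
intersections-constant C []       con = refl
intersections-constant C (D ∷ Ds) con =
  cong₂ ℕ._+_ (con D (here refl)) (intersections-constant C Ds λ E → con E ∘ there)

-- λ is added on the left to avoid the truncated subtraction in m − 1.
intersections-connected : ∀ {lam} {C : Subset n} {Ds} → Unique Ds → C ∈ˡ Ds →
  (∀ D → D ∈ˡ Ds → C ≢ D → ∣ C ∩ D ∣ ≡ lam) →
  lam ℕ.+ intersections C Ds ≡ ∣ C ∣ ℕ.+ length Ds ℕ.* lam
intersections-connected {lam = lam} {C} {_ ∷ Ds} (C∉Ds ∷ _) (here refl) con = begin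
  lam ℕ.+ (∣ C ∩ C ∣ ℕ.+ intersections C Ds)  ≡⟨ cong (lam ℕ.+_) (cong₂ ℕ._+_ (cong ∣_∣ (∩-idem C)) others) ⟩
  lam ℕ.+ (∣ C ∣ ℕ.+ length Ds ℕ.* lam)       ≡⟨ +-exchange lam ∣ C ∣ _ ⟩
  ∣ C ∣ ℕ.+ (lam ℕ.+ length Ds ℕ.* lam)       ∎
  where
  -- By distinctness `C` does not recur in `Ds`, so connectedness applies to every remaining clause.
  others : intersections C Ds ≡ length Ds ℕ.* lam
  others = intersections-constant C Ds λ D D∈ → con D (there D∈) (lookup C∉Ds D∈)
intersections-connected {lam = lam} {C} {D ∷ Ds} (D∉Ds ∷ uniq) (there C∈) con = begin
  lam ℕ.+ (∣ C ∩ D ∣ ℕ.+ intersections C Ds)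
    ≡⟨ cong₂ (λ a b → lam ℕ.+ (a ℕ.+ b)) (con D (here refl) (lookup D∉Ds C∈ ∘ sym)) refl ⟩
  lam ℕ.+ (lam ℕ.+ intersections C Ds)
    ≡⟨ cong (lam ℕ.+_) (intersections-connected uniq C∈ λ E → con E ∘ there) ⟩
  lam ℕ.+ (∣ C ∣ ℕ.+ length Ds ℕ.* lam)
    ≡⟨ +-exchange lam ∣ C ∣ _ ⟩
  ∣ C ∣ ℕ.+ (lam ℕ.+ length Ds ℕ.* lam)
    ∎

-- Equates the two counts. With the size written as `suc m`, the extra `lam` on the left cancels
-- against the term that `C` itself would have contributed.
clause-size : ∀ {l lam m} {C : Clause n} (F : Formula n) →
  Regular l F → ExactlyConnected lam F → C ∈ᶠ F → size F ≡ suc m →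
  ∣ C ∣ ℕ.* l ≡ ∣ C ∣ ℕ.+ m ℕ.* lam
clause-size {l = l} {lam} {m} {C} F reg con C∈F size≡ = ℕ.+-cancelˡ-≡ lam _ _ (begin
  lam ℕ.+ ∣ C ∣ ℕ.* l                  ≡⟨ cong (lam ℕ.+_) (intersections-regular C (clauses F) λ x → reg x ∘ ∈-⋃ C∈F) ⟨
  lam ℕ.+ intersections C (clauses F)  ≡⟨ intersections-connected (distinct F) C∈F (λ D → con C D C∈F) ⟩
  ∣ C ∣ ℕ.+ size F ℕ.* lam             ≡⟨ cong (λ s → ∣ C ∣ ℕ.+ s ℕ.* lam) size≡ ⟩
  ∣ C ∣ ℕ.+ (lam ℕ.+ m ℕ.* lam)        ≡⟨ +-exchange ∣ C ∣ lam _ ⟩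
  lam ℕ.+ (∣ C ∣ ℕ.+ m ℕ.* lam)        ∎)

-- For `l ≥ 2`, cancelling one copy of the unknown leaves a multiple by the positive number `l - 1`.
-- For `l = 0`, the sum of the unknown and `s` vanishes, so the unknown is zero.
*-solution-unique : ∀ {l s a b} → l ≢ 1 →
  a ℕ.* l ≡ a ℕ.+ s → b ℕ.* l ≡ b ℕ.+ s → a ≡ b
*-solution-unique {zero} {s} {a} {b} _ eqa eqb = trans (vanishes a eqa) (sym (vanishes b eqb))
  where
  vanishes : ∀ c → c ℕ.* 0 ≡ c ℕ.+ s → c ≡ 0
  vanishes c eq = ℕ.m+n≡0⇒m≡0 c (trans (sym eq) (ℕ.*-zeroʳ c))
*-solution-unique {suc zero} l≢1 _ _ = contradiction refl l≢1
*-solution-unique {suc (suc j)} {s} {a} {b} _ eqa eqb =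
  ℕ.*-cancelʳ-≡ a b (suc j) (trans (reduce a eqa) (sym (reduce b eqb)))
  where
  reduce : ∀ c → c ℕ.* suc (suc j) ≡ c ℕ.+ s → c ℕ.* suc j ≡ s
  reduce c eq = ℕ.+-cancelˡ-≡ c _ _ (trans (sym (ℕ.*-suc c (suc j))) eq)

-- Cancelling `k` leaves `m ℕ.* lam ≡ 0`.
lone-clause : ∀ {k m} lam → lam ≢ 0 → k ℕ.* 1 ≡ k ℕ.+ m ℕ.* lam → m ≡ 0
lone-clause {k} {m} lam lam≢0 eq with ℕ.m*n≡0⇒m≡0∨n≡0 m {lam}
  (ℕ.+-cancelˡ-≡ k _ _ (trans (sym eq) (trans (ℕ.*-identityʳ k) (sym (ℕ.+-identityʳ k)))))
... | inj₁ m≡0   = m≡0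
... | inj₂ lam≡0 = contradiction lam≡0 lam≢0

pos-equation : ∀ k l m lam → k ℕ.* l ≡ k ℕ.+ m ℕ.* lam →
  (+ lam) * (+ suc m - + 1) ≡ (+ k) * (+ l - + 1)
pos-equation k l m lam eq = begin
  + lam * (+ suc m - + 1)               ≡⟨ drop-one (+ lam) (+ m) (+ k) ⟩
  (+ k ℤ.+ + m * + lam) - + k           ≡⟨ cong (λ z → (+ k ℤ.+ z) - + k) (ℤ.pos-* m lam) ⟨
  + (k ℕ.+ m ℕ.* lam) - + k             ≡⟨ cong (λ z → + z - + k) eq ⟨
  + (k ℕ.* l) - + k                     ≡⟨ cong (_- + k) (ℤ.pos-* k l) ⟩
  + k * + l - + k                       ≡⟨ factor (+ k) (+ l) ⟩
  + k * (+ l - + 1)                     ∎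
  where
  -- `+ suc m` computes from `+ 1 ℤ.+ + m`; this form lets the ring solver treat `+ m` as a
  -- variable.
  drop-one : ∀ x y z → x * ((+ 1 ℤ.+ y) - + 1) ≡ (z ℤ.+ y * x) - z
  drop-one = solve-∀
  factor : ∀ x y → x * y - x ≡ x * (y - + 1)
  factor = solve-∀

lemma1 : ∀ {n : ℕ} (l lam : ℕ) (F : Formula n) →
    0 < size F →
    ¬ (lam ≡ 0 × l ≡ 1) →
    Regular l F → ExactlyConnected lam F →
    ∃[ k ] (Uniform k F ×
    (+ lam) * (+ size F - + 1) ≡ (+ k) * (+ l - + 1))
lemma1 l lam (formula [] _) () _ _ _
lemma1 l lam F@(formula (C ∷ Ds) _) _ nondegenerate reg con =
  -- The first clause, present since the formula is nonempty, supplies `k`; `length Ds` is the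
  -- number of clauses minus one.
  ∣ C ∣ , uniform , pos-equation ∣ C ∣ l (length Ds) lam (equation (here refl))
  where
  equation : ∀ {D} → D ∈ᶠ F → ∣ D ∣ ℕ.* l ≡ ∣ D ∣ ℕ.+ length Ds ℕ.* lam
  equation D∈F = clause-size F reg con D∈F refl

  uniform : Uniform ∣ C ∣ F
  uniform D (here refl) = refl
  uniform D (there D∈Ds) with l ℕ.≟ 1
  ... | no l≢1 = *-solution-unique l≢1 (equation (there D∈Ds)) (equation (here refl))
  -- When `l = 1` the equation does not determine the clause size, but it forces `Ds` to be empty,
  -- so there is no second clause `D` to compare.
  ... | yes refl = contradiction D∈Ds (∉-empty (lone-clause lam lam≢0 (equation (here refl))))
    where
    lam≢0 : lam ≢ 0
    lam≢0 lam≡0 = nondegenerate (lam≡0 , refl)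
    ∉-empty : ∀ {Es} → length Es ≡ 0 → ¬ D ∈ˡ Es
    ∉-empty {[]} _ ()
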